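{- For every integer $n\ge 1$, $$|RAI_{2n-1}(4321)|=M_n-M_{n-2},$$ where $M_k$ is the $k$-th Motzkin number and $M_{k}=0$ for $k<0$.
   Context: Let $S_n$ be the set of permutations $\pi=\pi_1\ldots\pi_n$ of $\{1,\ldots,n\}$. A permutation is reverse alternating if, for all $1\le i\le n-1$, $\pi_i>\pi_{i+1}$ if and only if $i$ is odd. $RAI_n$ is the set of reverse alternating involutions ($\pi=\pi^{ -1}$) in $S_n$. A permutation $\pi\in S_n$ avoids the pattern $\tau\in S_k$ if there are no indices $i_1<\cdots<i_k$ such that $\pi_{i_1}\ldots\pi_{i_k}$ is order-isomorphic to $\tau$; $RAI_n(\tau)$ is the set of elements of $RAI_n$ avoiding $\tau$. The Motzkin number $M_n$ ($n\ge 0$) is the number of Motzkin paths of length $n$, i.e. lattice paths from $(0,0)$ to $(n,0)$ with steps $U=(1,1)$, $D=(1,-1)$, $H=(1,0)$ that stay weakly above the $x$-axis (so $M_0=M_1=1$, $M_2=2$, $M_3=4$). -}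

module Defs where

open import Data.Fin.Base using (Fin; toℕ; _<_)
open import Data.Fin.Permutation using (Permutation′; _⟨$⟩ʳ_; _≈_; flip; reverse)
open import Data.Integer.Base using (ℤ; +_; -[1+_])
open import Data.List.Base using (List; []; _∷_; _++_; map; length)
open import Data.List.Membership.Propositional using (_∈_)
open import Data.List.Membership.Propositional.Properties
  using (∈-map⁺; ∈-map⁻; ∈-++⁺ˡ; ∈-++⁺ʳ; ∈-++⁻)
open import Data.List.Relation.Unary.All using ([])
open import Data.List.Relation.Unary.Any using (here)
open import Data.List.Relation.Unary.AllPairs using ([]; _∷_)
open import Data.List.Relation.Unary.Unique.Propositional using (Unique)
open import Data.List.Relation.Unary.Unique.Propositional.Properties using (map⁺; ++⁺)
open import Data.Nat.Base using (ℕ; zero; suc; parity)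
open import Data.Parity.Base using (1ℙ)
open import Data.Product.Base using (Σ-syntax; _×_; _,_; proj₁)
open import Data.Sum.Base using (inj₁; inj₂)
open import Function.Bundles using (_⇔_; Inverse)
open import Level using (0ℓ)
open import Relation.Binary.Bundles using (Setoid)
open import Relation.Binary.PropositionalEquality using (_≡_; refl; sym; trans; setoid)
open import Relation.Nullary.Negation using (¬_)

-- Positions and values 1, …, n are represented by Fin n, hence shifted down by
-- one: i and j are consecutive positions and suc (toℕ i) is the 1-based index
-- of i, so the condition says that descents occur exactly at odd indices.
ReverseAlternating : ∀ {n} → Permutation′ n → Set
ReverseAlternating {n} π =
  (i j : Fin n) → toℕ j ≡ suc (toℕ i) →
  (π ⟨$⟩ʳ j < π ⟨$⟩ʳ i) ⇔ (parity (suc (toℕ i)) ≡ 1ℙ)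

Involution : ∀ {n} → Permutation′ n → Set
Involution π = π ≈ flip π

Contains : ∀ {n k} → Permutation′ n → Permutation′ k → Set
Contains {n} {k} π τ =
  Σ[ ι ∈ (Fin k → Fin n) ]
    (∀ a b → a < b → ι a < ι b) ×
    (∀ a b → (π ⟨$⟩ʳ ι a < π ⟨$⟩ʳ ι b) ⇔ (τ ⟨$⟩ʳ a < τ ⟨$⟩ʳ b))

Avoids : ∀ {n k} → Permutation′ n → Permutation′ k → Set
Avoids π τ = ¬ Contains π τ

τ4321 : Permutation′ 4
τ4321 = reverse

-- Elements are compared as functions on positions; the accompanying proofs are
-- irrelevant to equality.
RAI : ∀ {k} → ℕ → Permutation′ k → Setoid 0ℓ 0ℓ
RAI n τ = record
  { Carrier = Σ[ π ∈ Permutation′ n ]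
                (ReverseAlternating π × Involution π × Avoids π τ)
  ; _≈_ = λ x y → proj₁ x ≈ proj₁ y
  ; isEquivalence = record
    { refl  = λ _ → refl
    ; sym   = λ p i → sym (p i)
    ; trans = λ p q i → trans (p i) (q i)
    }
  }

infix 4 _HasCardinality_

_HasCardinality_ : Setoid 0ℓ 0ℓ → ℕ → Set
S HasCardinality c = Inverse S (setoid (Fin c))

-- Path h n: lattice paths with n steps from height h to height 0.  Heights are
-- natural numbers, so these paths stay weakly above the axis.
data Path : ℕ → ℕ → Set where
  end : Path 0 0
  U   : ∀ {h n} → Path (suc h) n → Path h       (suc n)
  D   : ∀ {h n} → Path h n       → Path (suc h) (suc n)
  H   : ∀ {h n} → Path h n       → Path h       (suc n)

MotzkinPath : ℕ → Set
MotzkinPath n = Path 0 n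

paths : ∀ h n → List (Path h n)
paths zero    zero    = end ∷ []
paths (suc h) zero    = []
paths zero    (suc n) = map U (paths 1 n) ++ map H (paths 0 n)
paths (suc h) (suc n) =
  map U (paths (suc (suc h)) n) ++ map H (paths (suc h) n) ++ map D (paths h n)

-- The next two facts say that paths h n lists every path exactly once, so that
-- its length is the number of paths.
paths-complete : ∀ {h n} (p : Path h n) → p ∈ paths h n
paths-complete end = here refl
paths-complete {zero}  (U p) = ∈-++⁺ˡ (∈-map⁺ U (paths-complete p))
paths-complete {suc h} (U p) = ∈-++⁺ˡ (∈-map⁺ U (paths-complete p))
paths-complete {zero} {suc n} (H p) =
  ∈-++⁺ʳ (map U (paths 1 n)) (∈-map⁺ H (paths-complete p))
paths-complete {suc h} {suc n} (H p) =
  ∈-++⁺ʳ (map U (paths (suc (suc h)) n)) (∈-++⁺ˡ (∈-map⁺ H (paths-complete p)))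
paths-complete {suc h} {suc n} (D p) =
  ∈-++⁺ʳ (map U (paths (suc (suc h)) n))
    (∈-++⁺ʳ (map H (paths (suc h) n)) (∈-map⁺ D (paths-complete p)))

paths-unique : ∀ h n → Unique (paths h n)
paths-unique zero    zero    = [] ∷ []
paths-unique (suc h) zero    = []
paths-unique zero    (suc n) =
  ++⁺ (map⁺ (λ { refl → refl }) (paths-unique 1 n))
      (map⁺ (λ { refl → refl }) (paths-unique 0 n))
      λ { (u , v) → U≢H (∈-map⁻ U u) (∈-map⁻ H v) }
  where
  U≢H : ∀ {xs ys p} → (Σ[ x ∈ Path 1 n ] x ∈ xs × p ≡ U x) →
        ¬ (Σ[ y ∈ Path 0 n ] y ∈ ys × p ≡ H y)
  U≢H (_ , _ , refl) (_ , _ , ())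
paths-unique (suc h) (suc n) =
  ++⁺ (map⁺ (λ { refl → refl }) (paths-unique (suc (suc h)) n))
      (++⁺ (map⁺ (λ { refl → refl }) (paths-unique (suc h) n))
           (map⁺ (λ { refl → refl }) (paths-unique h n))
           λ { (u , v) → H≢D (∈-map⁻ H u) (∈-map⁻ D v) })
      λ { (u , v) → disj (∈-map⁻ U u) v }
  where
  H≢D : ∀ {xs ys p} → (Σ[ x ∈ Path (suc h) n ] x ∈ xs × p ≡ H x) →
        ¬ (Σ[ y ∈ Path h n ] y ∈ ys × p ≡ D y)
  H≢D (_ , _ , refl) (_ , _ , ())
  disj : ∀ {xs p} → (Σ[ x ∈ Path (suc (suc h)) n ] x ∈ xs × p ≡ U x) →
         ¬ (p ∈ map H (paths (suc h) n) ++ map D (paths h n))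
  disj (_ , _ , refl) v with ∈-++⁻ (map H (paths (suc h) n)) v
  ... | inj₁ w with ∈-map⁻ H w
  ...   | _ , _ , ()
  disj (_ , _ , refl) v | inj₂ w with ∈-map⁻ D w
  ...   | _ , _ , ()

motzkinPaths : ∀ n → List (MotzkinPath n)
motzkinPaths = paths 0

motzkin : ℤ → ℕ
motzkin (+ n)    = length (motzkinPaths n)
motzkin -[1+ _ ] = 0

{-# OPTIONS --safe #-}
module Submission where

-- An involution avoids 4321 iff no two of its arcs {y, π y} are nested.  Read
-- from left to right, arcs then close in the order in which they open, so π is
-- determined by the Motzkin path with a step U, D or H at each opener, closer or
-- fixed point, and every Motzkin path arises.  There is a descent at i exactly
-- where the letter goes up in the order U < H < D.  Hence the reverse
-- alternating involutions of length 2n - 1 correspond to n - 1 blocks UH, UD or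
-- HD followed by H, or by D after a block that ends in D.  Contracting the blocks
-- to U, H and D gives the Motzkin paths of length n that do not end in UD, of
-- which there are M_n - M_{n-2}.

open import Defs
open import Data.Bool.Base using (Bool; true; false)
open import Data.Empty using (⊥-elim)
open import Data.Fin.Base as Fin using (Fin; toℕ; fromℕ<)
open import Data.Fin.Patterns using (0F; 1F; 2F; 3F)
open import Data.Fin.Permutation
  using (Permutation′; permutation; _⟨$⟩ʳ_; inverseʳ) renaming (_≈_ to _≈ᵖ_)
open import Data.Fin.Properties as Fin
  using (toℕ<n; toℕ-injective; toℕ-fromℕ<; fromℕ<-toℕ; +↔⊎)
open import Data.Integer.Base using (+_; _-_; _⊖_)
open import Data.Integer.Properties using (m-n≡m⊖n; ⊖-≥)
open import Data.List.Base using (length; map)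
open import Data.List.Properties using (length-++; length-map)
open import Data.Nat.Base
  using (ℕ; zero; suc; pred; _+_; _*_; _∸_; _≤_; _<_; _≥_; z≤n; s≤s; parity)
open import Data.Nat.Properties
open import Data.Nat.Tactic.RingSolver using (solve-∀)
open import Data.Parity.Base using (0ℙ; 1ℙ)
open import Data.Parity.Properties using (suc-homo-⁻¹; ⁻¹-selfInverse)
open import Data.Product.Base using (Σ-syntax; _×_; _,_; proj₁; proj₂)
open import Data.Sum.Base using (_⊎_; inj₁; inj₂)
open import Data.Sum.Function.Propositional using (_⊎-↔_)
open import Data.Vec.Base using (Vec; []; _∷_; _∷ʳ_)
open import Data.Vec.Membership.Propositional using (_∈_)
open import Data.Vec.Relation.Unary.All as All using (All; []; _∷_)
open import Data.Vec.Relation.Unary.AllPairs using (AllPairs; []; _∷_)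
open import Data.Vec.Relation.Unary.Any using (here; there)
open import Function.Base using (_∘_; case_of_)
open import Function.Bundles using (_⇔_; _↔_; mk⇔; mk↔ₛ′; Equivalence; Inverse)
open import Function.Construct.Composition using (inverse)
open import Function.Properties.Inverse using (↔-sym; ↔-trans)
open import Relation.Binary.Bundles using (Setoid)
open import Relation.Binary.Definitions using (tri<; tri≈; tri>)
open import Relation.Binary.PropositionalEquality
open import Relation.Nullary using (¬_; yes; no; contradiction)
open import Relation.Nullary.Decidable using (from-yes; _→-dec_; _×-dec_)

open Equivalence using (to; from)

-- Nonnesting involutions and queues of open arcs.

record NonnestingInvolution (N : ℕ) (f : ℕ → ℕ) : Set where
  field
    involutive : ∀ y → f (f y) ≡ y
    outside    : ∀ {y} → N ≤ y → f y ≡ y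
    nonnesting : ∀ {a b} → a < b → b < f b → ¬ f b < f a

  injective : ∀ {y z} → f y ≡ f z → y ≡ z
  injective {y} {z} eq = trans (sym (involutive y)) (trans (cong f eq) (involutive z))

  bounded : ∀ {y} → y < N → f y < N
  bounded {y} y<N = ≰⇒> λ N≤fy →
    <⇒≱ y<N (subst (N ≤_) (trans (sym (outside N≤fy)) (involutive y)) N≤fy)

-- New openers are appended at the end, so the head is the oldest open arc, the one that a `D`
-- closes.
Increasing : ∀ {h} → ℕ → Vec ℕ h → Set
Increasing i q = AllPairs _<_ q × All (_< i) q

∈-∷ʳ⁺ : ∀ {h y z} {q : Vec ℕ h} → y ∈ q → y ∈ q ∷ʳ z
∈-∷ʳ⁺ (here eq) = here eq
∈-∷ʳ⁺ (there y∈q) = there (∈-∷ʳ⁺ y∈q)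

last-∈-∷ʳ : ∀ {h} (q : Vec ℕ h) {z} → z ∈ q ∷ʳ z
last-∈-∷ʳ [] = here refl
last-∈-∷ʳ (_ ∷ q) = there (last-∈-∷ʳ q)

∈-∷ʳ⁻ : ∀ {h y z} (q : Vec ℕ h) → y ∈ q ∷ʳ z → y ∈ q ⊎ y ≡ z
∈-∷ʳ⁻ [] (here eq) = inj₂ eq
∈-∷ʳ⁻ (_ ∷ q) (here eq) = inj₁ (here eq)
∈-∷ʳ⁻ (_ ∷ q) (there y∈) with ∈-∷ʳ⁻ q y∈
... | inj₁ y∈q = inj₁ (there y∈q)
... | inj₂ eq = inj₂ eq

All-∷ʳ⁺ : ∀ {P : ℕ → Set} {h z} {q : Vec ℕ h} → All P q → P z → All P (q ∷ʳ z)
All-∷ʳ⁺ [] pz = pz ∷ []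
All-∷ʳ⁺ (px ∷ pq) pz = px ∷ All-∷ʳ⁺ pq pz

AllPairs-∷ʳ⁺ : ∀ {h z} {q : Vec ℕ h} → AllPairs _<_ q → All (_< z) q → AllPairs _<_ (q ∷ʳ z)
AllPairs-∷ʳ⁺ [] [] = [] ∷ []
AllPairs-∷ʳ⁺ (x<q ∷ q↗) (x<z ∷ q<z) = All-∷ʳ⁺ x<q x<z ∷ AllPairs-∷ʳ⁺ q↗ q<z

increasing-suc : ∀ {h i} {q : Vec ℕ h} → Increasing i q → Increasing (suc i) q
increasing-suc (q↗ , q<i) = q↗ , All.map m<n⇒m<1+n q<i

increasing-∷ʳ : ∀ {h i} {q : Vec ℕ h} → Increasing i q → Increasing (suc i) (q ∷ʳ i)
increasing-∷ʳ (q↗ , q<i) = AllPairs-∷ʳ⁺ q↗ q<i , All-∷ʳ⁺ (All.map m<n⇒m<1+n q<i) ≤-refl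

increasing-tail : ∀ {h i x} {q : Vec ℕ h} → Increasing i (x ∷ q) → Increasing (suc i) q
increasing-tail (_ ∷ q↗ , _ ∷ q<i) = increasing-suc (q↗ , q<i)

∈⇒< : ∀ {h i y} {q : Vec ℕ h} → Increasing i q → y ∈ q → y < i
∈⇒< (_ , q<i) = All.lookup q<i

head<tail : ∀ {h i x y} {q : Vec ℕ h} → Increasing i (x ∷ q) → y ∈ q → x < y
head<tail (x<q ∷ _ , _) = All.lookup x<q

head<bound : ∀ {h i x} {q : Vec ℕ h} → Increasing i (x ∷ q) → x < i
head<bound (_ , x<i ∷ _) = x<i

-- Reading a path off an involution.

-- Reads f i q p: from position i on, p records whether each position opens an
-- arc of f (U), closes one (D) or is fixed (H).  The vector q is the queue of
-- positions before i whose arcs are still open.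
data Reads (f : ℕ → ℕ) : ∀ {h m} → ℕ → Vec ℕ h → Path h m → Set where
  end : ∀ {i} → Reads f i [] end
  U : ∀ {h m i} {q : Vec ℕ h} {p : Path (suc h) m} →
      i < f i → Reads f (suc i) (q ∷ʳ i) p → Reads f i q (U p)
  D : ∀ {h m i x} {q : Vec ℕ h} {p : Path h m} →
      f i ≡ x → x < i → Reads f (suc i) q p → Reads f i (x ∷ q) (D p)
  H : ∀ {h m i} {q : Vec ℕ h} {p : Path h m} →
      f i ≡ i → Reads f (suc i) q p → Reads f i q (H p)

Reads-cong : ∀ {f g : ℕ → ℕ} {h m i} {q : Vec ℕ h} {p : Path h m} →
             (∀ {y} → i ≤ y → f y ≡ g y) → Reads f i q p → Reads g i q p
Reads-cong f≗g end = end
Reads-cong f≗g (U i<fi r) = U (subst (_ <_) (f≗g ≤-refl) i<fi) (Reads-cong (f≗g ∘ m+n≤o⇒n≤o 1) r)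
Reads-cong f≗g (D fi≡x x<i r) = D (trans (sym (f≗g ≤-refl)) fi≡x) x<i (Reads-cong (f≗g ∘ m+n≤o⇒n≤o 1) r)
Reads-cong f≗g (H fi≡i r) = H (trans (sym (f≗g ≤-refl)) fi≡i) (Reads-cong (f≗g ∘ m+n≤o⇒n≤o 1) r)

-- The letter at `i` records whether `f i` is above, below or equal to `i`.
Reads-unique : ∀ {f : ℕ → ℕ} {h m i} {q : Vec ℕ h} {p p′ : Path h m} →
               Reads f i q p → Reads f i q p′ → p ≡ p′
Reads-unique end end = refl
Reads-unique (U _ r) (U _ r′) = cong U (Reads-unique r r′)
Reads-unique (D _ _ r) (D _ _ r′) = cong D (Reads-unique r r′)
Reads-unique (H _ r) (H _ r′) = cong H (Reads-unique r r′)
Reads-unique (U i<fi _) (D refl fi<i _) = contradiction fi<i (<-asym i<fi)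
Reads-unique (U i<fi _) (H fi≡i _) = contradiction (sym fi≡i) (<⇒≢ i<fi)
Reads-unique (D refl fi<i _) (U i<fi _) = contradiction fi<i (<-asym i<fi)
Reads-unique (D refl fi<i _) (H fi≡i _) = contradiction fi≡i (<⇒≢ fi<i)
Reads-unique (H fi≡i _) (U i<fi _) = contradiction (sym fi≡i) (<⇒≢ i<fi)
Reads-unique (H fi≡i _) (D refl fi<i _) = contradiction fi≡i (<⇒≢ fi<i)

<-+-suc : ∀ i {m y} → y < i + suc m → y < suc i + m
<-+-suc i {m} {y} = subst (y <_) (+-suc i m)

module _ {f g : ℕ → ℕ} (f-inv : ∀ y → f (f y) ≡ y) (g-inv : ∀ y → g (g y) ≡ y) where

  -- A `U` does not say where its arc closes. The value at an opener follows, by involutivity, only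
  -- when a later `D` takes it from the queue, so the induction has to cover the queue as well.
  Reads-determines : ∀ {h m i} {q : Vec ℕ h} {p : Path h m} → Reads f i q p → Reads g i q p →
                     ∀ {y} → y ∈ q ⊎ (i ≤ y × y < i + m) → f y ≡ g y
  Reads-determines {i = i} end end (inj₂ (i≤y , y<i)) =
    contradiction (subst (_ <_) (+-identityʳ i) y<i) (≤⇒≯ i≤y)
  Reads-determines (U _ r) (U _ r′) (inj₁ y∈q) =
    Reads-determines r r′ (inj₁ (∈-∷ʳ⁺ y∈q))
  Reads-determines {m = suc m} {i} {q} (U _ r) (U _ r′) (inj₂ (i≤y , y<)) with m≤n⇒m<n∨m≡n i≤y
  ... | inj₁ i<y = Reads-determines r r′ (inj₂ (i<y , <-+-suc i y<))
  ... | inj₂ refl = Reads-determines r r′ (inj₁ (last-∈-∷ʳ q))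
  Reads-determines {i = i} (D fi≡x _ _) (D gi≡x _ _) (inj₁ (here refl)) =
    trans (trans (cong f (sym fi≡x)) (f-inv i)) (sym (trans (cong g (sym gi≡x)) (g-inv i)))
  Reads-determines (D _ _ r) (D _ _ r′) (inj₁ (there y∈q)) = Reads-determines r r′ (inj₁ y∈q)
  Reads-determines {m = suc m} {i} (D fi≡x _ r) (D gi≡x _ r′) (inj₂ (i≤y , y<)) with m≤n⇒m<n∨m≡n i≤y
  ... | inj₁ i<y = Reads-determines r r′ (inj₂ (i<y , <-+-suc i y<))
  ... | inj₂ refl = trans fi≡x (sym gi≡x)
  Reads-determines (H _ r) (H _ r′) (inj₁ y∈q) = Reads-determines r r′ (inj₁ y∈q)
  Reads-determines {m = suc m} {i} (H fi≡i r) (H gi≡i r′) (inj₂ (i≤y , y<)) with m≤n⇒m<n∨m≡n i≤y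
  ... | inj₁ i<y = Reads-determines r r′ (inj₂ (i<y , <-+-suc i y<))
  ... | inj₂ refl = trans fi≡i (sym gi≡i)

module _ {N : ℕ} {f : ℕ → ℕ} (F : NonnestingInvolution N f) where
  open NonnestingInvolution F

  -- Since arcs do not nest, the arc closed at i is the one opened first.
  read : ∀ {h} i (q : Vec ℕ h) m → i + m ≡ N → Increasing i q →
         (∀ {y} → y ∈ q → i ≤ f y) → (∀ {y} → y < i → i ≤ f y → y ∈ q) →
         Σ[ p ∈ Path h m ] Reads f i q p
  read i [] zero _ _ _ _ = end , end
  -- An arc still open at the end would have to close at or beyond `N`.
  read i (x ∷ q) zero i≡N q↗ q⇒ _ = contradiction (q⇒ (here refl))
    (<⇒≱ (subst (f x <_) N≡i (bounded (subst (x <_) (sym N≡i) (head<bound q↗)))))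
    where N≡i = trans (sym i≡N) (+-identityʳ i)
  read i q (suc m) i+m≡N q↗ q⇒ q⇐ with <-cmp (f i) i
  ... | tri≈ _ fi≡i _ =
    let p , r = read (suc i) q m (trans (sym (+-suc i m)) i+m≡N) (increasing-suc q↗) q⇒′ q⇐′
    in H p , H fi≡i r
    where
    q⇒′ : ∀ {y} → y ∈ q → i < f y
    q⇒′ y∈q = ≤∧≢⇒< (q⇒ y∈q) λ i≡fy → <⇒≢ (∈⇒< q↗ y∈q) (injective (trans (sym i≡fy) (sym fi≡i)))
    q⇐′ : ∀ {y} → y < suc i → i < f y → y ∈ q
    q⇐′ y<1+i i<fy with m≤n⇒m<n∨m≡n (≤-pred y<1+i)
    ... | inj₁ y<i = q⇐ y<i (<⇒≤ i<fy)
    ... | inj₂ refl = contradiction (sym fi≡i) (<⇒≢ i<fy)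
  ... | tri> _ _ i<fi =
    let p , r = read (suc i) (q ∷ʳ i) m (trans (sym (+-suc i m)) i+m≡N) (increasing-∷ʳ q↗) q⇒′ q⇐′
    in U p , U i<fi r
    where
    q⇒′ : ∀ {y} → y ∈ q ∷ʳ i → i < f y
    q⇒′ y∈ with ∈-∷ʳ⁻ q y∈
    ... | inj₂ refl = i<fi
    ... | inj₁ y∈q = ≤∧≢⇒< (q⇒ y∈q) λ i≡fy →
      <-asym i<fi (subst (_< i) (trans (sym (involutive _)) (cong f (sym i≡fy))) (∈⇒< q↗ y∈q))
    q⇐′ : ∀ {y} → y < suc i → i < f y → y ∈ q ∷ʳ i
    q⇐′ y<1+i i<fy with m≤n⇒m<n∨m≡n (≤-pred y<1+i)
    ... | inj₁ y<i = ∈-∷ʳ⁺ (q⇐ y<i (<⇒≤ i<fy))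
    ... | inj₂ refl = last-∈-∷ʳ q
  -- The opener `f i` has partner `i`, so `q⇐` puts it into the queue; `pop` shows that it is the
  -- head.
  read i q (suc m) i+m≡N q↗ q⇒ q⇐ | tri< fi<i _ _ = pop q q↗ q⇒ q⇐ (q⇐ fi<i (≤-reflexive (sym (involutive i))))
    where
    pop : ∀ {h} (q : Vec ℕ h) → Increasing i q →
          (∀ {y} → y ∈ q → i ≤ f y) → (∀ {y} → y < i → i ≤ f y → y ∈ q) →
          f i ∈ q → Σ[ p ∈ Path h (suc m) ] Reads f i q p
    pop (x ∷ q) q↗ q⇒ q⇐ (there fi∈q) = ⊥-elim (nonnesting x<fi fi<ffi ffi<fx)
      where
      x<fi : x < f i
      x<fi = head<tail q↗ fi∈q
      fi<ffi : f i < f (f i)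
      fi<ffi = subst (f i <_) (sym (involutive i)) fi<i
      ffi<fx : f (f i) < f x
      ffi<fx = ≤∧≢⇒< (subst (_≤ f x) (sym (involutive i)) (q⇒ (here refl)))
                     λ eq → <⇒≢ x<fi (sym (injective eq))
    pop (x ∷ q) q↗ q⇒ q⇐ (here fi≡x) =
      let p , r = read (suc i) q m (trans (sym (+-suc i m)) i+m≡N) (increasing-tail q↗) q⇒′ q⇐′
      in D p , D fi≡x (head<bound q↗) r
      where
      i≡fx : i ≡ f x
      i≡fx = trans (sym (involutive i)) (cong f fi≡x)
      q⇒′ : ∀ {y} → y ∈ q → i < f y
      q⇒′ y∈q = ≤∧≢⇒< (q⇒ (there y∈q)) λ i≡fy →
        <⇒≢ (head<tail q↗ y∈q) (injective (trans (sym i≡fx) i≡fy))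
      q⇐′ : ∀ {y} → y < suc i → i < f y → y ∈ q
      q⇐′ y<1+i i<fy with m≤n⇒m<n∨m≡n (≤-pred y<1+i)
      ... | inj₂ refl = contradiction fi<i (<-asym i<fy)
      ... | inj₁ y<i with q⇐ y<i (<⇒≤ i<fy)
      ...   | there y∈q = y∈q
      ...   | here refl = contradiction i≡fx (<⇒≢ i<fy)

-- The nonnesting involution of a path.

link : ℕ → ℕ → (ℕ → ℕ) → ℕ → ℕ
link x i g y with y ≟ x | y ≟ i
... | yes _ | _     = i
... | no _  | yes _ = x
... | no _  | no _  = g y

data Linked (x i : ℕ) (g : ℕ → ℕ) (y : ℕ) : ℕ → Set where
  left  : y ≡ x → Linked x i g y i
  right : y ≡ i → Linked x i g y x
  other : y ≢ x → y ≢ i → Linked x i g y (g y)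

linked : ∀ x i g y → Linked x i g y (link x i g y)
linked x i g y with y ≟ x | y ≟ i
... | yes y≡x | _       = left y≡x
... | no _    | yes y≡i = right y≡i
... | no y≢x  | no y≢i  = other y≢x y≢i

module _ {x i : ℕ} {g : ℕ → ℕ} where

  link-left : link x i g x ≡ i
  link-left with link x i g x | linked x i g x
  ... | _ | left _ = refl
  ... | _ | right x≡i = x≡i
  ... | _ | other x≢x _ = contradiction refl x≢x

  link-right : link x i g i ≡ x
  link-right with link x i g i | linked x i g i
  ... | _ | left i≡x = i≡x
  ... | _ | right _ = refl
  ... | _ | other _ i≢i = contradiction refl i≢i

  link-other : ∀ {y} → y ≢ x → y ≢ i → link x i g y ≡ g y
  link-other {y} y≢x y≢i with link x i g y | linked x i g y
  ... | _ | left y≡x = contradiction y≡x y≢x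
  ... | _ | right y≡i = contradiction y≡i y≢i
  ... | _ | other _ _ = refl

  -- As `g` fixes `x` and `i`, it sends no other point to either of them, so the new arc does not
  -- disturb the old ones.
  link-involutive : (∀ y → g (g y) ≡ y) → g x ≡ x → g i ≡ i → ∀ y → link x i g (link x i g y) ≡ y
  link-involutive g-inv gx≡x gi≡i y with link x i g y | linked x i g y
  ... | _ | left refl = link-right
  ... | _ | right refl = link-left
  ... | _ | other y≢x y≢i = trans (link-other (≢ gx≡x y≢x) (≢ gi≡i y≢i)) (g-inv y)
    where
    ≢ : ∀ {z} → g z ≡ z → y ≢ z → g y ≢ z
    ≢ gz≡z y≢z gy≡z = y≢z (trans (sym (g-inv y)) (trans (cong g gy≡z) gz≡z))

-- Inverse to reading: positions are fixed by default, and only a `D` adds an arc, from the head of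
-- the queue to its own position.
partner : ∀ {h m} → Path h m → Vec ℕ h → ℕ → ℕ → ℕ
partner end   []      i = λ y → y
partner (U p) q       i = partner p (q ∷ʳ i) (suc i)
partner (D p) (x ∷ q) i = link x i (partner p q (suc i))
partner (H p) q       i = partner p q (suc i)

∉-increasing : ∀ {h i y} {q : Vec ℕ h} → Increasing i q → i ≤ y → ¬ y ∈ q
∉-increasing q↗ i≤y y∈q = <⇒≱ (∈⇒< q↗ y∈q) i≤y

-- An arc added from `i` on closes at a position from `i` on and opens either there or in `q`;
-- earlier positions outside `q` keep the default.
partner-low : ∀ {h m} (p : Path h m) (q : Vec ℕ h) {i y} → y < i →
              y ∈ q ⊎ partner p q i y ≡ y
partner-low end [] y<i = inj₂ refl
partner-low (U p) q {i} y<i with partner-low p (q ∷ʳ i) (m<n⇒m<1+n y<i)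
... | inj₂ eq = inj₂ eq
... | inj₁ y∈ with ∈-∷ʳ⁻ q y∈
...   | inj₁ y∈q = inj₁ y∈q
...   | inj₂ refl = contradiction y<i (<-irrefl refl)
partner-low (D p) (x ∷ q) {i} {y} y<i with link x i (partner p q (suc i)) y | linked x i (partner p q (suc i)) y
... | _ | left y≡x = inj₁ (here y≡x)
... | _ | right refl = contradiction y<i (<-irrefl refl)
... | _ | other _ _ with partner-low p q (m<n⇒m<1+n y<i)
...   | inj₁ y∈q = inj₁ (there y∈q)
...   | inj₂ eq = inj₂ eq
partner-low (H p) q y<i = partner-low p q (m<n⇒m<1+n y<i)

partner-fixes : ∀ {h m} (p : Path h m) (q : Vec ℕ h) {i y} → y < i → ¬ y ∈ q →
                partner p q i y ≡ y
partner-fixes p q y<i y∉q with partner-low p q y<i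
... | inj₁ y∈q = contradiction y∈q y∉q
... | inj₂ eq = eq

-- The path ends at height 0, so a `D` at some position from `i` on removes each entry of the queue.
partner-open : ∀ {h m} (p : Path h m) {q : Vec ℕ h} {i y} → Increasing i q → y ∈ q →
               i ≤ partner p q i y
partner-open (U p) q↗ y∈q = <⇒≤ (partner-open p (increasing-∷ʳ q↗) (∈-∷ʳ⁺ y∈q))
partner-open (D p) {x ∷ q} {i} q↗ (here refl) = ≤-reflexive (sym (link-left {x} {i}))
partner-open (D p) q↗ (there y∈q) =
  subst (_ ≤_) (sym (link-other (>⇒≢ (head<tail q↗ y∈q)) (<⇒≢ (∈⇒< q↗ (there y∈q)))))
    (<⇒≤ (partner-open p (increasing-tail q↗) y∈q))
partner-open (H p) q↗ y∈q = <⇒≤ (partner-open p (increasing-suc q↗) y∈q)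

-- Only a `D` adds an arc, joining the head `x` to `i`. The openers left in the queue lie after `x`
-- and close after `i`, and the rest of the path fixes all other positions before `i`, so the new
-- arc neither contains an arc nor lies in one.
partner-nonnesting : ∀ {h m} (p : Path h m) {q : Vec ℕ h} {i} → Increasing i q →
                     NonnestingInvolution (i + m) (partner p q i)
partner-nonnesting end {[]} _ = record
  { involutive = λ _ → refl
  ; outside    = λ _ → refl
  ; nonnesting = λ a<b b<b _ → <-irrefl refl b<b
  }
partner-nonnesting {m = suc m} (U p) {q} {i} q↗ =
  subst (λ N → NonnestingInvolution N (partner p (q ∷ʳ i) (suc i))) (sym (+-suc i m))
    (partner-nonnesting p (increasing-∷ʳ q↗))
partner-nonnesting {m = suc m} (H p) {q} {i} q↗ =
  subst (λ N → NonnestingInvolution N (partner p q (suc i))) (sym (+-suc i m)) (partner-nonnesting p (increasing-suc q↗))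
partner-nonnesting {m = suc m} (D p) {x ∷ q} {i} q↗ = record
  { involutive = link-involutive involutive
      (partner-fixes p q (m<n⇒m<1+n x<i) (<-irrefl refl ∘ head<tail q↗))
      (partner-fixes p q ≤-refl (∉-increasing q↗ ≤-refl ∘ there))
  ; outside = λ {y} i+m≤y → let i<y = <-≤-trans (m<m+n i (s≤s z≤n)) i+m≤y in
      trans (link-other (>⇒≢ (<-trans x<i i<y)) (>⇒≢ i<y)) (outside (subst (_≤ y) (+-suc i m) i+m≤y))
  ; nonnesting = nonnesting′
  }
  where
  g = partner p q (suc i)
  x<i : x < i
  x<i = head<bound q↗
  open NonnestingInvolution (partner-nonnesting p (increasing-tail q↗))
  nonnesting′ : ∀ {a b} → a < b → b < link x i g b → ¬ link x i g b < link x i g a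
  nonnesting′ {a} {b} a<b b<b′ b′<a′
    with link x i g b | linked x i g b | link x i g a | linked x i g a
  ... | _ | right refl | _ | _ = <-asym x<i b<b′
  ... | _ | left refl | _ | left refl = <-irrefl refl a<b
  ... | _ | left refl | _ | right refl = <-asym x<i b′<a′
  ... | _ | left refl | _ | other _ _ with partner-low p q (<-trans a<b (m<n⇒m<1+n x<i))
  ...   | inj₁ a∈q = <-asym a<b (head<tail q↗ a∈q)
  ...   | inj₂ ga≡a = <-asym a<b (<-trans x<i (subst (i <_) ga≡a b′<a′))
  nonnesting′ {a} {b} a<b b<b′ b′<a′ | _ | other _ _ | _ | right refl =
    <-asym (<-trans a<b b<b′) (<-trans b′<a′ x<i)
  nonnesting′ {a} {b} a<b b<b′ b′<a′ | _ | other _ _ | _ | other _ _ = nonnesting a<b b<b′ b′<a′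
  nonnesting′ {a} {b} a<b b<b′ b′<a′ | _ | other _ _ | _ | left refl
    with partner-low p q (m<n⇒m<1+n (<-trans b<b′ b′<a′))
  ... | inj₁ b∈q = <⇒≱ b′<a′ (<⇒≤ (partner-open p (increasing-tail q↗) b∈q))
  ... | inj₂ gb≡b = <⇒≢ b<b′ (sym gb≡b)

partner-reads : ∀ {h m} (p : Path h m) {q : Vec ℕ h} {i} → Increasing i q →
                Reads (partner p q i) i q p
partner-reads end {[]} _ = end
partner-reads (U p) {q} q↗ =
  U (partner-open p (increasing-∷ʳ q↗) (last-∈-∷ʳ q)) (partner-reads p (increasing-∷ʳ q↗))
partner-reads (D p) {x ∷ q} {i} q↗ = D (link-right {x} {i}) x<i
  -- The new arc changes values only at `x` and `i`, both already passed.
  (Reads-cong (λ i<y → sym (link-other (>⇒≢ (<-trans x<i i<y)) (>⇒≢ i<y)))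
    (partner-reads p (increasing-tail q↗)))
  where x<i = head<bound q↗
partner-reads (H p) {q} q↗ =
  H (partner-fixes p q ≤-refl (∉-increasing q↗ ≤-refl)) (partner-reads p (increasing-suc q↗))

-- Reverse alternation and words made of blocks.

RevAlternating : ℕ → (ℕ → ℕ) → Set
RevAlternating N f = ∀ {i} → suc i < N → f (suc i) < f i ⇔ parity (suc i) ≡ 1ℙ

-- The words of height h with k blocks; b tells whether D may be the first letter,
-- that is, whether the preceding letter is D.
data Zig : Bool → ℕ → ℕ → Set where
  H  : ∀ {b} → Zig b 0 0
  D  : Zig true 1 0
  UH : ∀ {b h k} → Zig false (suc h) k → Zig b h (suc k)
  UD : ∀ {b h k} → Zig true h k → Zig b h (suc k)
  HD : ∀ {b h k} → Zig true h k → Zig b (suc h) (suc k)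

-- With the length written through `k * 2`, one more block adds two steps by computation.
word : ∀ {b h k} → Zig b h k → Path h (suc (k * 2))
word H      = H end
word D      = D end
word (UH z) = U (H (word z))
word (UD z) = U (D (word z))
word (HD z) = H (D (word z))

U-injective : ∀ {h m} {p p′ : Path (suc h) m} → _≡_ {A = Path h (suc m)} (U p) (U p′) → p ≡ p′
U-injective refl = refl

H-injective : ∀ {h m} {p p′ : Path h m} → _≡_ {A = Path h (suc m)} (H p) (H p′) → p ≡ p′
H-injective refl = refl

D-injective : ∀ {h m} {p p′ : Path h m} → _≡_ {A = Path (suc h) (suc m)} (D p) (D p′) → p ≡ p′
D-injective refl = refl

word-injective : ∀ {b h k} (z z′ : Zig b h k) → word z ≡ word z′ → z ≡ z′
word-injective H H _ = refl
word-injective D D _ = refl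
word-injective (UH z) (UH z′) eq = cong UH (word-injective z z′ (H-injective (U-injective eq)))
word-injective (UD z) (UD z′) eq = cong UD (word-injective z z′ (D-injective (U-injective eq)))
word-injective (HD z) (HD z′) eq = cong HD (word-injective z z′ (D-injective (H-injective eq)))
word-injective (UH _) (UD _) ()
word-injective (UH _) (HD _) ()
word-injective (UD _) (UH _) ()
word-injective (UD _) (HD _) ()
word-injective (HD _) (UH _) ()
word-injective (HD _) (UD _) ()

even⇒suc-odd : ∀ i → parity i ≡ 0ℙ → parity (suc i) ≡ 1ℙ
even⇒suc-odd i even = sym (⁻¹-selfInverse (trans (suc-homo-⁻¹ i) even))

+-2+ : ∀ m n → m + suc (suc n) ≡ suc (suc m) + n
+-2+ m n = trans (+-suc m (suc n)) (cong suc (+-suc m n))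

module _ {N : ℕ} {f : ℕ → ℕ} (F : NonnestingInvolution N f) where
  open NonnestingInvolution F

  -- If `i` closed an arc, its opener `f i` would lie after `f (suc i)`, and the arc ending at
  -- `suc i` would contain it.
  descent⇒¬closer : ∀ {i} → f (suc i) < f i → i ≤ f i
  descent⇒¬closer {i} desc = ≮⇒≥ λ fi<i → nonnesting desc (subst (f i <_) (sym (involutive i)) fi<i)
    (subst₂ _<_ (sym (involutive i)) (sym (involutive (suc i))) ≤-refl)

  -- If `suc i` opened an arc, the arc opened at `i` would end after it.
  descent⇒¬opener : ∀ {i} → f (suc i) < f i → f (suc i) ≤ suc i
  descent⇒¬opener desc = ≮⇒≥ λ 1+i<f → nonnesting ≤-refl 1+i<f desc

  fixed⇒f-suc≢ : ∀ {i} → f i ≡ i → i ≢ f (suc i)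
  fixed⇒f-suc≢ fi≡i i≡f = <⇒≢ ≤-refl (injective (trans fi≡i i≡f))

  nonclosing : ∀ {h k i} {q : Vec ℕ h} (z : Zig false h k) → Reads f i q (word z) → i ≤ f i
  nonclosing H (H fi≡i _) = ≤-reflexive (sym fi≡i)
  nonclosing (UH _) (U i<fi _) = <⇒≤ i<fi
  nonclosing (UD _) (U i<fi _) = <⇒≤ i<fi
  nonclosing (HD _) (H fi≡i _) = ≤-reflexive (sym fi≡i)

  module _ (alt : RevAlternating N f) where

    -- Positions count from 0, so blocks start at even `i`. The descent there leaves only `UH`, `UD`
    -- and `HD`. The guard carries the ascent after `UH` to the next block, which then cannot start
    -- with `D`.
    unword : ∀ {h} b k {i} {q : Vec ℕ h} {p : Path h (suc (k * 2))} →
             i + suc (k * 2) ≡ N → parity i ≡ 0ℙ → (b ≡ false → i ≤ f i) →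
             Reads f i q p → Σ[ z ∈ Zig b h k ] word z ≡ p
    unword b zero _ _ _ (U _ ())
    unword b zero _ _ _ (H _ end) = H , refl
    unword true zero _ _ _ (D _ _ end) = D , refl
    unword false zero _ _ guard (D refl fi<i end) = contradiction (guard refl) (<⇒≱ fi<i)
    unword b (suc k) {i} i+m≡N even _ r = blocks r
      where
      i+2+m≡N : suc (suc i) + suc (k * 2) ≡ N
      i+2+m≡N = trans (sym (+-2+ i _)) i+m≡N
      2+i<N : suc (suc i) < N
      2+i<N = subst (suc (suc i) <_) i+2+m≡N (m<m+n _ (s≤s z≤n))
      desc : f (suc i) < f i
      desc = from (alt (<⇒≤ 2+i<N)) (even⇒suc-odd i even)
      asc : f (suc i) ≤ f (suc (suc i))
      asc = ≮⇒≥ λ d → case trans (sym even) (to (alt 2+i<N) d) of λ ()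
      afterU : ∀ {h} {q : Vec ℕ (suc h)} {p : Path (suc h) (suc (suc (k * 2)))} →
               Reads f (suc i) q p → Σ[ z ∈ Zig b h (suc k) ] word z ≡ U p
      afterU (U 1+i<f _) = contradiction (descent⇒¬opener desc) (<⇒≱ 1+i<f)
      afterU (H f≡1+i r) =
        let z , eq = unword false k i+2+m≡N even
              -- The ascent from the fixed point `suc i` is strict by injectivity, so the next
              -- position closes no arc.
              (λ _ → ≤∧≢⇒< (subst (_≤ f (suc (suc i))) f≡1+i asc) (fixed⇒f-suc≢ f≡1+i)) r
        in UH z , cong (λ p → U (H p)) eq
      afterU (D _ _ r) =
        let z , eq = unword true k i+2+m≡N even (λ ()) r in UD z , cong (λ p → U (D p)) eq
      afterH : ∀ {h} {q : Vec ℕ h} {p : Path h (suc (suc (k * 2)))} → f i ≡ i →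
               Reads f (suc i) q p → Σ[ z ∈ Zig b h (suc k) ] word z ≡ H p
      afterH _ (U 1+i<f _) = contradiction (descent⇒¬opener desc) (<⇒≱ 1+i<f)
      afterH fi≡i (H f≡1+i _) = contradiction desc (<-asym (subst₂ _<_ (sym fi≡i) (sym f≡1+i) ≤-refl))
      afterH _ (D _ _ r) =
        let z , eq = unword true k i+2+m≡N even (λ ()) r in HD z , cong (λ p → H (D p)) eq
      blocks : ∀ {h} {q : Vec ℕ h} {p : Path h (suc (suc (suc (k * 2))))} →
               Reads f i q p → Σ[ z ∈ Zig b h (suc k) ] word z ≡ p
      blocks (U _ r) = afterU r
      blocks (H fi≡i r) = afterH fi≡i r
      blocks (D refl fi<i _) = contradiction (descent⇒¬closer desc) (<⇒≱ fi<i)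

  -- What the induction needs from a block, whichever its letters; flag, height and queue of the
  -- remaining word are hidden.
  data Block (i k : ℕ) : Set where
    block : ∀ {b h} {q : Vec ℕ h} (z : Zig b h k) → f (suc i) < f i → ¬ f (suc (suc i)) < f (suc i) →
            Reads f (suc (suc i)) q (word z) → Block i k

  -- The ascent after the block has two reasons: after `UH` the flag `false` keeps the next position
  -- from closing an arc, and after `UD` or `HD` no descent can start at a closer.
  first-block : ∀ {b h k i} {q : Vec ℕ h} (z : Zig b h (suc k)) → Reads f i q (word z) → Block i k
  first-block {i = i} (UH z) (U i<fi (H f≡1+i r)) = block z
    (subst (_< f i) (sym f≡1+i)
      (≤∧≢⇒< i<fi λ 1+i≡fi → <⇒≢ ≤-refl (injective (trans (sym 1+i≡fi) (sym f≡1+i)))))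
    (λ d → <⇒≱ (subst (f (suc (suc i)) <_) f≡1+i d) (<⇒≤ (nonclosing z r))) r
  first-block {h = h} {k} {i} (UD z) (U i<fi r) = closed r
    where
    -- The queue becomes a variable because `q ∷ʳ i` does not unify with the `x ∷ q` that `D`
    -- requires.
    closed : {q : Vec ℕ (suc h)} → Reads f (suc i) q (D (word z)) → Block i k
    closed (D refl f<1+i r) =
      block z (≤-<-trans (≤-pred f<1+i) i<fi) (λ d → <⇒≱ f<1+i (descent⇒¬closer d)) r
  first-block {i = i} (HD z) (H fi≡i (D refl f<1+i r)) =
    block z (subst (f (suc i) <_) (sym fi≡i) (≤∧≢⇒< (≤-pred f<1+i) (fixed⇒f-suc≢ fi≡i ∘ sym)))
      (λ d → <⇒≱ f<1+i (descent⇒¬closer d)) r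

  -- Each block settles two positions, the descent at the even `i` and the ascent at `suc i`; the
  -- remaining word settles the later ones.
  alternating : ∀ {b h} k {i} {q : Vec ℕ h} (z : Zig b h k) → Reads f i q (word z) →
                i + suc (k * 2) ≡ N → parity i ≡ 0ℙ →
                ∀ {j} → i ≤ j → suc j < N → f (suc j) < f j ⇔ parity (suc j) ≡ 1ℙ
  alternating zero {i} _ _ i+1≡N _ i≤j 1+j<N =
    contradiction (s≤s i≤j) (<⇒≱ (subst (_ <_) (trans (sym i+1≡N) (+-comm i 1)) 1+j<N))
  alternating (suc k) {i} z r i+m≡N even i≤j 1+j<N with first-block z r | m≤n⇒m<n∨m≡n i≤j
  ... | block _ desc _ _ | inj₂ refl = mk⇔ (λ _ → even⇒suc-odd i even) (λ _ → desc)
  ... | block z′ _ asc r′ | inj₁ i<j with m≤n⇒m<n∨m≡n i<j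
  ...   | inj₂ refl = mk⇔ (⊥-elim ∘ asc) (λ odd → case trans (sym even) odd of λ ())
  ...   | inj₁ 1+i<j = alternating k z′ r′
            (trans (sym (+-2+ i _)) i+m≡N) even 1+i<j 1+j<N

-- Counting words and Motzkin paths.

#paths : ℕ → ℕ → ℕ
#paths h n = length (paths h n)

#paths-zero : ∀ n → #paths 0 (suc n) ≡ #paths 1 n + #paths 0 n
#paths-zero n = trans (length-++ (map U (paths 1 n)))
  (cong₂ _+_ (length-map U (paths 1 n)) (length-map H (paths 0 n)))

#paths-suc : ∀ h n → #paths (suc h) (suc n) ≡ #paths (suc (suc h)) n + (#paths (suc h) n + #paths h n)
#paths-suc h n = trans (length-++ (map U (paths (suc (suc h)) n)))
  (cong₂ _+_ (length-map U (paths (suc (suc h)) n))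
    (trans (length-++ (map H (paths (suc h) n)))
      (cong₂ _+_ (length-map H (paths (suc h) n)) (length-map D (paths h n)))))

-- No block starts with `D`, so the flag matters only when no block is left, for the final `D` from
-- height 1.
#zigs : Bool → ℕ → ℕ → ℕ
#zigs b     zero          (suc k) = #zigs false 1 k + #zigs true 0 k
#zigs b     (suc h)       (suc k) =
  #zigs false (suc (suc h)) k + (#zigs true (suc h) k + #zigs true h k)
#zigs b     (suc (suc h)) zero    = 0
#zigs b     zero          zero    = 1
#zigs true  (suc zero)    zero    = 1
#zigs false (suc zero)    zero    = 0

Zig↔Fin : ∀ b h k → Zig b h k ↔ Fin (#zigs b h k)
Zig↔Fin b zero zero =
  mk↔ₛ′ (λ { H → 0F }) (λ { 0F → H }) (λ { 0F → refl }) (λ { H → refl })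
Zig↔Fin true (suc zero) zero =
  mk↔ₛ′ (λ { D → 0F }) (λ { 0F → D }) (λ { 0F → refl }) (λ { D → refl })
Zig↔Fin false (suc zero) zero = mk↔ₛ′ (λ ()) (λ ()) (λ ()) (λ ())
Zig↔Fin b (suc (suc h)) zero = mk↔ₛ′ (λ ()) (λ ()) (λ ()) (λ ())
Zig↔Fin b zero (suc k) =
  ↔-trans (mk↔ₛ′ (λ { (UH z) → inj₁ z ; (UD z) → inj₂ z })
                 (λ { (inj₁ z) → UH z ; (inj₂ z) → UD z })
                 (λ { (inj₁ _) → refl ; (inj₂ _) → refl })
                 (λ { (UH _) → refl ; (UD _) → refl }))
  (↔-trans (Zig↔Fin false 1 k ⊎-↔ Zig↔Fin true 0 k) (↔-sym +↔⊎))
Zig↔Fin b (suc h) (suc k) =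
  ↔-trans (mk↔ₛ′ (λ { (UH z) → inj₁ z ; (UD z) → inj₂ (inj₁ z) ; (HD z) → inj₂ (inj₂ z) })
                 (λ { (inj₁ z) → UH z ; (inj₂ (inj₁ z)) → UD z ; (inj₂ (inj₂ z)) → HD z })
                 (λ { (inj₁ _) → refl ; (inj₂ (inj₁ _)) → refl ; (inj₂ (inj₂ _)) → refl })
                 (λ { (UH _) → refl ; (UD _) → refl ; (HD _) → refl }))
  (↔-trans (Zig↔Fin false (suc (suc h)) k ⊎-↔
             ↔-trans (Zig↔Fin true (suc h) k ⊎-↔ Zig↔Fin true h k) (↔-sym +↔⊎))
           (↔-sym +↔⊎))

-- A path of length k + 2 contracts from a zig unless it ends in UD; removing
-- that ending leaves a path of length k.
#zigs+#paths : ∀ b h k → #zigs b h (suc k) + #paths h k ≡ #paths h (suc (suc k))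
#zigs+#paths true  zero                zero = refl
#zigs+#paths false zero                zero = refl
#zigs+#paths true  (suc zero)          zero = refl
#zigs+#paths false (suc zero)          zero = refl
#zigs+#paths true  (suc (suc zero))    zero = refl
#zigs+#paths false (suc (suc zero))    zero = refl
#zigs+#paths true  (suc (suc (suc h))) zero = refl
#zigs+#paths false (suc (suc (suc h))) zero = refl
-- A first block `UH`, `UD` or `HD` changes the height as a first step `U`, `H` or `D` does, so both
-- sides obey the same recurrence.
#zigs+#paths b zero (suc k)
  rewrite #paths-zero k | #paths-zero (suc (suc k))
        | sym (#zigs+#paths false 1 k) | sym (#zigs+#paths true 0 k) =
  rearrange (#zigs false 1 (suc k)) (#zigs true 0 (suc k)) (#paths 1 k) (#paths 0 k)
  where
  rearrange : ∀ a b x y → (a + b) + (x + y) ≡ (a + x) + (b + y)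
  rearrange = solve-∀
#zigs+#paths b (suc h) (suc k)
  rewrite #paths-suc h k | #paths-suc h (suc (suc k))
        | sym (#zigs+#paths false (suc (suc h)) k) | sym (#zigs+#paths true (suc h) k)
        | sym (#zigs+#paths true h k) =
  rearrange (#zigs false (suc (suc h)) (suc k)) (#zigs true (suc h) (suc k)) (#zigs true h (suc k))
            (#paths (suc (suc h)) k) (#paths (suc h) k) (#paths h k)
  where
  rearrange : ∀ a b c x y z → (a + (b + c)) + (x + (y + z)) ≡ (a + x) + ((b + y) + (c + z))
  rearrange = solve-∀

-- Permutations as functions on the naturals, and avoidance of 4321.

value : ∀ {N} → Permutation′ N → ℕ → ℕ
value {N} π y with y <? N
... | yes y<N = toℕ (π ⟨$⟩ʳ fromℕ< y<N)
... | no _    = y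

module _ {N : ℕ} (π : Permutation′ N) where

  value-toℕ : ∀ i → value π (toℕ i) ≡ toℕ (π ⟨$⟩ʳ i)
  value-toℕ i with toℕ i <? N
  ... | yes i<N = cong (λ j → toℕ (π ⟨$⟩ʳ j)) (fromℕ<-toℕ i i<N)
  ... | no i≮N = contradiction (toℕ<n i) i≮N

  value-outside : ∀ {y} → N ≤ y → value π y ≡ y
  value-outside {y} N≤y with y <? N
  ... | yes y<N = contradiction N≤y (<⇒≱ y<N)
  ... | no _ = refl

index : ∀ {N y} → y < N → Σ[ i ∈ Fin N ] toℕ i ≡ y
index y<N = fromℕ< y<N , toℕ-fromℕ< y<N

value-cong : ∀ {N} {π ρ : Permutation′ N} → π ≈ᵖ ρ → ∀ y → value π y ≡ value ρ y
value-cong {N} π≈ρ y with y <? N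
... | yes y<N = cong toℕ (π≈ρ (fromℕ< y<N))
... | no _ = refl

module _ {A : Set} {_≺_ : A → A → Set} (≺-trans : ∀ {x y z} → x ≺ y → y ≺ z → x ≺ z) where

  -- Serves the positions of an occurrence of 4321 with the usual order and its values with the
  -- reversed one.
  chain₄ : (v : Fin 4 → A) → v 0F ≺ v 1F → v 1F ≺ v 2F → v 2F ≺ v 3F →
           ∀ a b → a Fin.< b → v a ≺ v b
  chain₄ v p q r 0F 1F _ = p
  chain₄ v p q r 0F 2F _ = ≺-trans p q
  chain₄ v p q r 0F 3F _ = ≺-trans p (≺-trans q r)
  chain₄ v p q r 1F 2F _ = q
  chain₄ v p q r 1F 3F _ = ≺-trans q r
  chain₄ v p q r 2F 3F _ = r
  chain₄ v p q r 1F 1F (s≤s ())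
  chain₄ v p q r 2F 1F (s≤s ())
  chain₄ v p q r 3F 1F (s≤s ())
  chain₄ v p q r 2F 2F (s≤s (s≤s ()))
  chain₄ v p q r 3F 2F (s≤s (s≤s ()))
  chain₄ v p q r 3F 3F (s≤s (s≤s (s≤s ())))

-- That `τ4321` reverses the order is decided on all pairs in `Fin 4`; trichotomy then gives the
-- forward direction.
antitone⇒⇔τ4321 : ∀ {N} (v : Fin 4 → Fin N) → (∀ a b → a Fin.< b → v b Fin.< v a) →
                  ∀ a b → (v a Fin.< v b) ⇔ (τ4321 ⟨$⟩ʳ a Fin.< τ4321 ⟨$⟩ʳ b)
antitone⇒⇔τ4321 v v↘ a b = mk⇔ reverses (v↘ b a ∘ proj₂ (reversal a b))
  where
  reversal : ∀ (a b : Fin 4) → (b Fin.< a → τ4321 ⟨$⟩ʳ a Fin.< τ4321 ⟨$⟩ʳ b) ×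
                               (τ4321 ⟨$⟩ʳ a Fin.< τ4321 ⟨$⟩ʳ b → b Fin.< a)
  reversal = from-yes (Fin.all? λ a → Fin.all? λ b →
    ((b Fin.<? a) →-dec (τ4321 ⟨$⟩ʳ a Fin.<? τ4321 ⟨$⟩ʳ b)) ×-dec
    ((τ4321 ⟨$⟩ʳ a Fin.<? τ4321 ⟨$⟩ʳ b) →-dec (b Fin.<? a)))
  reverses : v a Fin.< v b → τ4321 ⟨$⟩ʳ a Fin.< τ4321 ⟨$⟩ʳ b
  reverses va<vb with Fin.<-cmp a b
  ... | tri< a<b _ _ = contradiction (v↘ a b a<b) (<-asym va<vb)
  ... | tri≈ _ refl _ = contradiction va<vb (<-irrefl refl)
  ... | tri> _ _ b<a = proj₁ (reversal a b) b<a

module _ {N : ℕ} {π : Permutation′ N} where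

  involution-twice : Involution π → ∀ i → π ⟨$⟩ʳ (π ⟨$⟩ʳ i) ≡ i
  involution-twice inv i = trans (cong (π ⟨$⟩ʳ_) (inv i)) (inverseʳ π)

  value-involutive : Involution π → ∀ y → value π (value π y) ≡ y
  value-involutive inv y with y <? N
  ... | yes y<N = trans (value-toℕ π _)
                    (trans (cong toℕ (involution-twice inv (fromℕ< y<N))) (toℕ-fromℕ< y<N))
  ... | no y≮N = value-outside π (≮⇒≥ y≮N)

  -- The positions `a`, `b`, `π b`, `π a` carry the values `π a`, `π b`, `b`, `a`.
  nesting⇒Contains : Involution π → ∀ {a b} → a Fin.< b → b Fin.< π ⟨$⟩ʳ b → π ⟨$⟩ʳ b Fin.< π ⟨$⟩ʳ a →
                     Contains π τ4321
  nesting⇒Contains inv {a} {b} a<b b<πb πb<πa =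
    ι , chain₄ {_≺_ = Fin._<_} <-trans ι a<b b<πb πb<πa ,
    antitone⇒⇔τ4321 (λ i → π ⟨$⟩ʳ ι i)
      (chain₄ {_≺_ = λ x y → y Fin.< x} (λ y<x z<y → <-trans z<y y<x) (λ i → π ⟨$⟩ʳ ι i) πb<πa
        (subst (Fin._< π ⟨$⟩ʳ b) (sym (involution-twice inv b)) b<πb)
        (subst₂ Fin._<_ (sym (involution-twice inv a)) (sym (involution-twice inv b)) a<b))
    where
    ι : Fin 4 → Fin N
    ι 0F = a
    ι 1F = b
    ι 2F = π ⟨$⟩ʳ b
    ι 3F = π ⟨$⟩ʳ a

  value-nonnesting : Involution π → Avoids π τ4321 → NonnestingInvolution N (value π)
  value-nonnesting inv avoids = record
    { involutive = value-involutive inv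
    ; outside = value-outside π
    ; nonnesting = nonnesting
    }
    where
    nonnesting : ∀ {a b} → a < b → b < value π b → ¬ value π b < value π a
    nonnesting {a} {b} a<b b<πb πb<πa with a <? N | b <? N
    ... | yes a<N | yes b<N = avoids (nesting⇒Contains inv
            (subst₂ _<_ (sym (toℕ-fromℕ< a<N)) (sym (toℕ-fromℕ< b<N)) a<b)
            (subst (_< toℕ (π ⟨$⟩ʳ fromℕ< b<N)) (sym (toℕ-fromℕ< b<N)) b<πb)
            πb<πa)
    ... | _ | no _ = <-irrefl refl b<πb
    ... | no _ | yes _ = <-asym a<b (<-trans b<πb πb<πa)

  value-alternating : ReverseAlternating π → RevAlternating N (value π)
  value-alternating alt {i} 1+i<N with index (<⇒≤ 1+i<N) | index 1+i<N
  ... | a , refl | b , b≡1+a =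
    subst₂ (λ u v → u < v ⇔ parity (suc (toℕ a)) ≡ 1ℙ)
      (trans (sym (value-toℕ π b)) (cong (value π) b≡1+a)) (sym (value-toℕ π a)) (alt a b b≡1+a)

-- In an occurrence of 4321 the arcs at the first two entries are nested if the
-- second entry exceeds its position, and the arcs at the last two otherwise.
avoids4321 : ∀ {N} {π : Permutation′ N} → NonnestingInvolution N (value π) → Avoids π τ4321
avoids4321 {π = π} F (ι , ι↗ , ι⇔) = case x 1F <? f (x 1F) of λ
  { (yes x₁<fx₁) → nonnesting (ι↗ 0F 1F ≤-refl) x₁<fx₁ (f↘ 0F 1F ≤-refl)
  ; (no x₁≮fx₁) → nonnesting (f↘ 2F 3F ≤-refl)
      (subst (f (x 2F) <_) (sym (involutive (x 2F)))
        (<-trans (f↘ 1F 2F ≤-refl) (≤-<-trans (≮⇒≥ x₁≮fx₁) (ι↗ 1F 2F ≤-refl))))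
      (subst₂ _<_ (sym (involutive (x 2F))) (sym (involutive (x 3F))) (ι↗ 2F 3F ≤-refl))
  }
  where
  open NonnestingInvolution F
  f = value π
  x : Fin 4 → ℕ
  x a = toℕ (ι a)
  f↘ : ∀ a b → τ4321 ⟨$⟩ʳ b Fin.< τ4321 ⟨$⟩ʳ a → f (x b) < f (x a)
  f↘ a b = subst₂ _<_ (sym (value-toℕ π (ι b))) (sym (value-toℕ π (ι a))) ∘ from (ι⇔ b a)

-- From functions back to permutations.

module _ {N : ℕ} {f : ℕ → ℕ} (F : NonnestingInvolution N f) where
  open NonnestingInvolution F

  private
    restrict : Fin N → Fin N
    restrict i = fromℕ< (bounded (toℕ<n i))

    restrict-involutive : ∀ i → restrict (restrict i) ≡ i
    restrict-involutive i = toℕ-injective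
      (trans (toℕ-fromℕ< _) (trans (cong f (toℕ-fromℕ< _)) (involutive (toℕ i))))

  restriction : Permutation′ N
  restriction = permutation restrict restrict restrict-involutive restrict-involutive

  value-restriction : ∀ y → value restriction y ≡ f y
  value-restriction y with y <? N
  ... | yes y<N = trans (toℕ-fromℕ< _) (cong f (toℕ-fromℕ< y<N))
  ... | no y≮N = sym (outside (≮⇒≥ y≮N))

  restriction-alternating : RevAlternating N f → ReverseAlternating restriction
  restriction-alternating alt i j j≡1+i =
    subst₂ (λ u v → u < v ⇔ parity (suc (toℕ i)) ≡ 1ℙ)
      (trans (cong f (sym j≡1+i)) (sym (toℕ-fromℕ< _))) (sym (toℕ-fromℕ< _))
      (alt (subst (_< N) j≡1+i (toℕ<n j)))

  value-restriction-nonnesting : NonnestingInvolution N (value restriction)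
  value-restriction-nonnesting = record
    { involutive = value-involutive {π = restriction} λ _ → refl
    ; outside = value-outside restriction
    ; nonnesting = λ {a} {b} a<b b<fb fb<fa → nonnesting a<b
        (subst (b <_) (value-restriction b) b<fb)
        (subst₂ _<_ (value-restriction b) (value-restriction a) fb<fa)
    }

-- The bijection with words and the count.

module _ (k : ℕ) where
  private N = suc (k * 2)

  decode : (x : Setoid.Carrier (RAI N τ4321)) →
           Σ[ z ∈ Zig true 0 k ] Reads (value (proj₁ x)) 0 [] (word z)
  decode (π , alt , inv , avoids) =
    let F = value-nonnesting inv avoids
        p , r = read F 0 [] N refl ([] , []) (λ ()) (λ ())
        -- The flag `true` makes the guard vacuous; at height 0 no word starts with `D` anyway.
        z , eq = unword F (value-alternating alt) true k refl refl (λ ()) r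
    in z , subst (Reads (value π) 0 []) (sym eq) r

  module _ (z : Zig true 0 k) where
    private
      F : NonnestingInvolution N (partner (word z) [] 0)
      F = partner-nonnesting (word z) ([] , [])

    encode : Setoid.Carrier (RAI N τ4321)
    encode = restriction F ,
      restriction-alternating F
        (alternating F k z (partner-reads (word z) ([] , [])) refl refl z≤n) ,
      -- `restriction` has the same function in both directions, so it agrees with its flip by
      -- definition.
      (λ _ → refl) , avoids4321 (value-restriction-nonnesting F)

    encode-reads : Reads (value (proj₁ encode)) 0 [] (word z)
    encode-reads = Reads-cong (λ {y} _ → sym (value-restriction F y)) (partner-reads (word z) ([] , []))

  -- A word is recognised by its reading, so congruence of decoding and one inverse law reduce to
  -- exhibiting a reading.
  decode-unique : ∀ x z → Reads (value (proj₁ x)) 0 [] (word z) → proj₁ (decode x) ≡ z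
  decode-unique x z r = word-injective _ _ (Reads-unique (proj₂ (decode x)) r)

  RAI↔Zig : Inverse (RAI N τ4321) (setoid (Zig true 0 k))
  RAI↔Zig = record
    { to        = proj₁ ∘ decode
    ; from      = encode
    ; to-cong   = λ {x} {y} → decode-cong x y
    ; from-cong = λ { refl _ → refl }
    ; inverse   = (λ {z} {x} x≈ →
                     trans (decode-cong x (encode z) x≈) (decode-unique (encode z) z (encode-reads z)))
                , λ { {x} refl → encode∘decode x }
    }
    where
    decode-cong : ∀ x y → proj₁ x ≈ᵖ proj₁ y → proj₁ (decode x) ≡ proj₁ (decode y)
    decode-cong x y x≈y = decode-unique x (proj₁ (decode y))
      (Reads-cong (λ {i} _ → sym (value-cong {π = proj₁ x} {proj₁ y} x≈y i)) (proj₂ (decode y)))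
    encode∘decode : ∀ x → proj₁ (encode (proj₁ (decode x))) ≈ᵖ proj₁ x
    encode∘decode x@(π , _ , inv , _) i = toℕ-injective
      -- Both permutations are read as the same word from the empty queue, hence agree everywhere.
      (trans (sym (value-toℕ ρ i))
        (trans (Reads-determines (value-involutive {π = ρ} λ _ → refl) (value-involutive inv)
                 (encode-reads z) (proj₂ (decode x)) (inj₂ (z≤n , toℕ<n i)))
          (value-toℕ π i)))
      where
      z = proj₁ (decode x)
      ρ = proj₁ (encode z)

theorem5p4 : (n : ℕ) → n ≥ 1 →
    Σ[ c ∈ ℕ ] ((RAI (2 * n ∸ 1) τ4321 HasCardinality c) ×
    (+ c ≡ + motzkin (+ n) - + motzkin (+ n - + 2)))
theorem5p4 (suc k) _ = #zigs true 0 k ,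
  -- `2 * suc k ∸ 1` equals `suc (k * 2)`: two letters for each of `k` blocks and one final letter.
  subst (λ N → RAI N τ4321 HasCardinality #zigs true 0 k) (cong pred (*-comm (suc k) 2))
    (inverse (RAI↔Zig k) (Zig↔Fin true 0 k)) ,
  difference k
  where
  difference : ∀ k → + #zigs true 0 k ≡ + motzkin (+ suc k) - + motzkin (+ suc k - + 2)
  -- Here `n - 2` is negative, where `motzkin` is 0; the only word is `H`.
  difference zero = refl
  difference (suc k) = begin
    + #zigs true 0 (suc k)                      ≡⟨ cong +_ (m+n∸n≡m (#zigs true 0 (suc k)) (#paths 0 k)) ⟨
    + (#zigs true 0 (suc k) + #paths 0 k ∸ #paths 0 k)
      ≡⟨ cong (λ m → + (m ∸ #paths 0 k)) (#zigs+#paths true 0 k) ⟩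
    + (#paths 0 (suc (suc k)) ∸ #paths 0 k)
      -- The same identity bounds the subtrahend, so truncated and integer subtraction agree.
      ≡⟨ ⊖-≥ (m+n≤o⇒n≤o (#zigs true 0 (suc k)) (≤-reflexive (#zigs+#paths true 0 k))) ⟨
    #paths 0 (suc (suc k)) ⊖ #paths 0 k
      ≡⟨ m-n≡m⊖n (#paths 0 (suc (suc k))) (#paths 0 k) ⟨
    + #paths 0 (suc (suc k)) - + #paths 0 k     ∎
    where open ≡-Reasoning
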